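{- Let $X$ be a permutative LD-system with a unique left-identity $1$. Then (1) there exists a unique binary operation $\circ$ on $X$ such that $(x*y)\circ x=x\circ y$ and $x=x\circ1$ for all $x,y\in X$; (2) the algebra $(X,*,\circ,1)$ is an LD-monoid; and (3) if $(x_1,\dots,x_n),(y_1,\dots,y_n)\in X^n$, $s\in B_n^+$ is an element with $(x_1,\dots,x_n)\cdot s=(y_1,\dots,y_n)$, and $j\in\{1,\dots,n\}$ is such that $y_i=1$ for all $i\ne j$, then $y_j=x_1\circ\dots\circ x_n$.
   Context: An LD-system is a set $X$ with a binary operation $*$ satisfying $x*(y*z)=(x*y)*(x*z)$. A left-identity is an $x\in X$ with $x*y=y$ for all $y\in X$; $\mathrm{Li}(X)$ is the set of left-identities. $X$ is permutative if $\mathrm{Li}(X)$ is a left-ideal ($y\in\mathrm{Li}(X)\Rightarrow x*y\in\mathrm{Li}(X)$ for all $x$) and for all $x,y\in X$ there is $n\ge1$ with $t_n(x,y)\in\mathrm{Li}(X)$, where $t_1(x,y)=y$, $t_2(x,y)=x$, $t_{n+2}(x,y)=t_{n+1}(x,y)*t_n(x,y)$. An LD-monoid is an algebra $(X,*,\circ,1)$ such that $(X,\circ,1)$ is a monoid and the identities $(x\circ y)*z=x*(y*z)$, $x*(y\circ z)=(x*y)\circ(x*z)$, $x\circ y=(x*y)\circ x$, $1*x=x$, $x*1=1$ hold. $B_n^+$ is the positive braid monoid: generators $\sigma_1,\dots,\sigma_{n-1}$, relations $\sigma_i\sigma_j=\sigma_j\sigma_i$ for $|i-j|>1$ and $\sigma_i\sigma_{i+1}\sigma_i=\sigma_{i+1}\sigma_i\sigma_{i+1}$.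 It acts on the right on $X^n$ (Hurwitz action) by $(x_1,\dots,x_n)\sigma_i=(x_1,\dots,x_{i-1},x_i*x_{i+1},x_i,x_{i+2},\dots,x_n)$. (Any two elements $r,s\in B_n^+$ have a common right multiple $rt=su$.) -}

module Defs where

open import Algebra.Bundles using (Magma; Monoid)
open import Algebra.Core using (Op₂)
import Algebra.Definitions as Definitions
import Algebra.Structures as Structures
open import Data.Fin.Base using (Fin; zero; suc; toℕ)
open import Data.List.Base using (List; []; _∷_; [_]; _++_; foldl)
open import Data.List.Properties using (foldl-++; ++-assoc; ++-identityʳ)
open import Data.Nat.Base using (ℕ; zero; suc; pred; _>_; ∣_-_∣; s≤s)
open import Data.Product.Base using (_×_; ∃; _,_)
open import Data.Vec.Base using (Vec; []; _∷_; lookup; foldr′)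
open import Data.Vec.Relation.Binary.Pointwise.Inductive as Pointwise
  using (Pointwise; []; _∷_)
open import Level using (0ℓ; _⊔_) renaming (suc to lsuc)
open import Relation.Binary.Core using (Rel)
open import Relation.Binary.PropositionalEquality.Core as ≡
  using (_≡_; _≢_)

-- Sets are setoids throughout: an operation is required to respect _≈_, and
-- equality of elements means _≈_.

record LDSystem c ℓ : Set (lsuc (c ⊔ ℓ)) where
  field
    magma : Magma c ℓ
  open Magma magma public renaming (_∙_ to infixl 7 _*_; ∙-cong to *-cong)
  open Definitions _≈_ public using (_DistributesOverˡ_; LeftIdentity)
  field
    *-distribˡ-* : _*_ DistributesOverˡ _*_

record IsLDMonoid {c ℓ} {A : Set c} (_≈_ : Rel A ℓ)
                  (_*_ _∘_ : Op₂ A) (1# : A) : Set (c ⊔ ℓ) where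
  open Definitions _≈_
  open Structures _≈_ using (IsMonoid)
  field
    ∘-isMonoid   : IsMonoid _∘_ 1#
    *-cong       : Congruent₂ _*_
    ∘-*-action   : ∀ x y z → ((x ∘ y) * z) ≈ (x * (y * z))
    *-distribˡ-∘ : _*_ DistributesOverˡ _∘_
    ∘-exchange   : ∀ x y → (x ∘ y) ≈ ((x * y) ∘ x)
    *-identityˡ  : LeftIdentity 1# _*_
    *-zeroʳ      : RightZero 1# _*_

module _ {c ℓ} (X : LDSystem c ℓ) where
  open LDSystem X
  open Definitions _≈_ using (Congruent₂)

  Li : Carrier → Set (c ⊔ ℓ)
  Li x = LeftIdentity x _*_

  -- The index is shifted by one: t k x y is the term usually numbered k + 1,
  -- so that k ranges over all of ℕ.
  t : ℕ → Carrier → Carrier → Carrier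
  t zero          x y = y
  t (suc zero)    x y = x
  t (suc (suc k)) x y = t (suc k) x y * t k x y

  record IsPermutative : Set (c ⊔ ℓ) where
    field
      Li-leftIdeal : ∀ x {y} → Li y → Li (x * y)
      t-reaches-Li : ∀ x y → ∃ λ k → Li (t k x y)

  record IsExchangeOp (1# : Carrier) (_∘_ : Op₂ Carrier) : Set (c ⊔ ℓ) where
    field
      ∘-cong    : Congruent₂ _∘_
      exchange  : ∀ x y → ((x * y) ∘ x) ≈ (x ∘ y)
      identityʳ : ∀ x → x ≈ (x ∘ 1#)

  IsUniqueLeftIdentity : Carrier → Set (c ⊔ ℓ)
  IsUniqueLeftIdentity 1# = Li 1# × (∀ e → Li e → e ≈ 1#)

  infix 4 _≐_
  _≐_ : Rel (Op₂ Carrier) (c ⊔ ℓ)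
  _∘₁_ ≐ _∘₂_ = ∀ x y → (x ∘₁ y) ≈ (x ∘₂ y)

-- Words in the generators of the braid monoid on n strands; the generator
-- σ_i (1 ≤ i ≤ n - 1) is the element of Fin (pred n) with toℕ equal to i - 1.
BraidWord : ℕ → Set
BraidWord n = List (Fin (pred n))

infix 4 _⊢_≈ᴮ_
data _⊢_≈ᴮ_ (n : ℕ) : Rel (BraidWord n) 0ℓ where
  far-comm : ∀ i j → ∣ toℕ i - toℕ j ∣ > 1 → n ⊢ i ∷ [ j ] ≈ᴮ j ∷ [ i ]
  braid    : ∀ i j → toℕ j ≡ suc (toℕ i) → n ⊢ i ∷ j ∷ [ i ] ≈ᴮ j ∷ i ∷ [ j ]
  ++-cong  : ∀ {u u′ v v′} → n ⊢ u ≈ᴮ u′ → n ⊢ v ≈ᴮ v′ → n ⊢ u ++ v ≈ᴮ u′ ++ v′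
  refl     : ∀ {u} → n ⊢ u ≈ᴮ u
  sym      : ∀ {u v} → n ⊢ u ≈ᴮ v → n ⊢ v ≈ᴮ u
  trans    : ∀ {u v w} → n ⊢ u ≈ᴮ v → n ⊢ v ≈ᴮ w → n ⊢ u ≈ᴮ w

B⁺ : ℕ → Monoid 0ℓ 0ℓ
B⁺ n = record
  { Carrier  = BraidWord n
  ; _≈_      = n ⊢_≈ᴮ_
  ; _∙_      = _++_
  ; ε        = []
  ; isMonoid = record
    { isSemigroup = record
      { isMagma = record
        { isEquivalence = record { refl = refl ; sym = sym ; trans = trans }
        ; ∙-cong        = ++-cong
        }
      ; assoc = λ u v w → ≡⇒≈ᴮ (++-assoc u v w)
      }
    ; identity = (λ _ → refl) , λ u → ≡⇒≈ᴮ (++-identityʳ u)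
    }
  }
  where
  ≡⇒≈ᴮ : ∀ {u v : BraidWord n} → u ≡ v → n ⊢ u ≈ᴮ v
  ≡⇒≈ᴮ ≡.refl = refl

module Hurwitz {c ℓ} (X : LDSystem c ℓ) where
  open LDSystem X using (Carrier; _≈_; _*_; *-cong; *-distribˡ-*)
  private module X = LDSystem X

  infix 4 _≋_
  _≋_ : ∀ {n} → Rel (Vec Carrier n) (c ⊔ ℓ)
  _≋_ = Pointwise _≈_

  infixl 6 _·σ_ _·_
  _·σ_ : ∀ {n} → Vec Carrier n → Fin (pred n) → Vec Carrier n
  (x ∷ y ∷ xs)     ·σ zero  = (x * y) ∷ x ∷ xs
  (x ∷ xs@(_ ∷ _)) ·σ suc i = x ∷ (xs ·σ i)

  _·_ : ∀ {n} → Vec Carrier n → Monoid.Carrier (B⁺ n) → Vec Carrier n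
  _·_ = foldl _·σ_

  ≋-refl : ∀ {n} {xs : Vec Carrier n} → xs ≋ xs
  ≋-refl = Pointwise.refl X.refl

  ≋-sym : ∀ {n} {xs ys : Vec Carrier n} → xs ≋ ys → ys ≋ xs
  ≋-sym = Pointwise.sym X.sym

  ≋-trans : ∀ {n} {xs ys zs : Vec Carrier n} → xs ≋ ys → ys ≋ zs → xs ≋ zs
  ≋-trans = Pointwise.trans X.trans

  private
    ·σ-cong : ∀ {n} {xs ys : Vec Carrier n} i → xs ≋ ys → xs ·σ i ≋ ys ·σ i
    ·σ-cong zero    (p ∷ q ∷ r)      = *-cong p q ∷ p ∷ r
    ·σ-cong (suc i) (p ∷ ps@(_ ∷ _)) = p ∷ ·σ-cong i ps

    ·-congʳ : ∀ {n} {xs ys : Vec Carrier n} s → xs ≋ ys → xs · s ≋ ys · s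
    ·-congʳ []      p = p
    ·-congʳ (i ∷ s) p = ·-congʳ s (·σ-cong i p)

    far-comm-· : ∀ {n} (xs : Vec Carrier n) i j → ∣ toℕ i - toℕ j ∣ > 1 →
                 xs ·σ i ·σ j ≋ xs ·σ j ·σ i
    far-comm-· (_ ∷ _ ∷ _)           zero          zero          ()
    far-comm-· (_ ∷ _ ∷ _)           zero          (suc zero)    (s≤s ())
    far-comm-· (_ ∷ _ ∷ _ ∷ _)       zero          (suc (suc _)) _ = ≋-refl
    far-comm-· (_ ∷ _ ∷ _)           (suc zero)    zero          (s≤s ())
    far-comm-· (_ ∷ _ ∷ _ ∷ _)       (suc (suc _)) zero          _ = ≋-refl
    far-comm-· (_ ∷ xs@(x ∷ xs′))    (suc i)       (suc j)       p =
      ·σ-suc xs i j (far-comm-· xs i j p)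
      where
      ·σ-suc : ∀ {n y} (xs : Vec Carrier (suc n)) i j →
               xs ·σ i ·σ j ≋ xs ·σ j ·σ i →
               (y ∷ xs) ·σ suc i ·σ suc j ≋ (y ∷ xs) ·σ suc j ·σ suc i
      ·σ-suc xs@(_ ∷ _) i j eq with xs ·σ i | xs ·σ j
      ... | _ ∷ _ | _ ∷ _ = X.refl ∷ eq

    braid-· : ∀ {n} (xs : Vec Carrier n) i j → toℕ j ≡ suc (toℕ i) →
              xs ·σ i ·σ j ·σ i ≋ xs ·σ j ·σ i ·σ j
    braid-· (x ∷ y ∷ z ∷ _) zero (suc zero) _ =
      X.sym (*-distribˡ-* x y z) ∷ ≋-refl
    braid-· (_ ∷ xs@(_ ∷ _)) (suc i) (suc j) p =
      ·σ-suc xs i j (braid-· xs i j (≡.cong pred p))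
      where
      ·σ-suc : ∀ {n y} (xs : Vec Carrier (suc n)) i j →
               xs ·σ i ·σ j ·σ i ≋ xs ·σ j ·σ i ·σ j →
               (y ∷ xs) ·σ suc i ·σ suc j ·σ suc i ≋
               (y ∷ xs) ·σ suc j ·σ suc i ·σ suc j
      ·σ-suc xs@(_ ∷ _) i j eq with xs ·σ i | xs ·σ j
      ... | as@(_ ∷ _) | bs@(_ ∷ _) with as ·σ j | bs ·σ i
      ...   | _ ∷ _ | _ ∷ _ = X.refl ∷ eq

    ·-congˡ : ∀ {n} (xs : Vec Carrier n) {s s′} → n ⊢ s ≈ᴮ s′ → xs · s ≋ xs · s′
    ·-congˡ xs (far-comm i j p) = far-comm-· xs i j p
    ·-congˡ xs (braid i j p)    = braid-· xs i j p
    ·-congˡ xs (++-cong {u} {u′} {v} {v′} p q)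
      rewrite foldl-++ _·σ_ xs u v | foldl-++ _·σ_ xs u′ v′ =
      ≋-trans (·-congʳ v (·-congˡ xs p)) (·-congˡ (xs · u′) q)
    ·-congˡ xs refl             = ≋-refl
    ·-congˡ xs (sym p)          = ≋-sym (·-congˡ xs p)
    ·-congˡ xs (trans p q)      = ≋-trans (·-congˡ xs p) (·-congˡ xs q)

  -- Words equal in the braid monoid act equally, so _·_ is an action of B⁺ n.
  ·-cong : ∀ {n} {xs ys : Vec Carrier n} {s s′ : BraidWord n} →
           xs ≋ ys → n ⊢ s ≈ᴮ s′ → xs · s ≋ ys · s′
  ·-cong {ys = ys} {s} p q = ≋-trans (·-congʳ s p) (·-congˡ ys q)

  ·-++ : ∀ {n} (xs : Vec Carrier n) (s s′ : BraidWord n) →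
         xs · (s ++ s′) ≡ xs · s · s′
  ·-++ = foldl-++ _·σ_

  -- Whenever s carries x to a tuple y that is 1# away from position j, the
  -- remaining entry of y is x₁ ∘ ⋯ ∘ xₙ.  The product is
  -- x₁ ∘ (⋯ ∘ (xₙ ∘ 1#)); it is used only where (_∘_ , 1#) is a monoid.
  ReductionGivesProduct : Carrier → Op₂ Carrier → Set (c ⊔ ℓ)
  ReductionGivesProduct 1# _∘_ =
    ∀ n (x y : Vec Carrier n) (s : Monoid.Carrier (B⁺ n)) → x · s ≋ y →
    (j : Fin n) → (∀ i → i ≢ j → lookup y i ≈ 1#) →
    lookup y j ≈ foldr′ _∘_ 1# x

{-# OPTIONS --safe #-}
-- Write (x , y) ↦ (x * y , x) for the Hurwitz move on two strands.  Permutativity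
-- says that iterating it from any pair reaches some (z , 1), and z does not depend
-- on when one stops, so x ∘ y := z is forced and well defined.  Identities
-- invariant under the move need only be checked at y = 1.
--
-- Associativity is not of that kind.  Let Δ act on triples by
-- (x , y , z) ↦ (x * (y * z) , x * y , x).  The two bracketings of a triple v are
-- exchanged by Δ, so they agree at v as soon as they agree at Δᵏ v.  As in
-- Garside's theory, σᵢ divides Δ and Δ interchanges σ₁ and σ₂, so a suitable power
-- of Δ takes v to a triple with an entry 1, where the bracketings agree.
module Submission where

open import Algebra.Core using (Op₂)
open import Data.Fin.Base using (zero; suc)
open import Data.List.Base using ([]; _∷_)
open import Data.Nat.Base using (zero; suc)
open import Data.Product using (∃; ∃!; _×_; _,_; Σ-syntax; proj₁; proj₂)
open import Data.Vec.Base using (Vec; []; _∷_; lookup; foldr′)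
open import Data.Vec.Relation.Binary.Pointwise.Inductive using ([]; _∷_)
open import Defs hiding (refl; sym; trans)
open import Level using (_⊔_)
open import Relation.Binary.PropositionalEquality as ≡ using (_≡_)
import Relation.Binary.Reasoning.Setoid as SetoidReasoning

module _ {c ℓ} (X : LDSystem c ℓ) where
  open LDSystem X

  -- Each move drops the first term of the sequence, so the index supplied by permutativity can
  -- serve as a recursion measure.
  t-shift : ∀ k x y → t X (suc k) x y ≡ t X k (x * y) x
  t-shift zero          x y = ≡.refl
  t-shift (suc zero)    x y = ≡.refl
  t-shift (suc (suc k)) x y = ≡.cong₂ _*_ (t-shift (suc k) x y) (t-shift k x y)

module PermutativeLDSystem {c ℓ} (X : LDSystem c ℓ) (permutative : IsPermutative X)
         (1# : LDSystem.Carrier X) (unique : IsUniqueLeftIdentity X 1#) where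
  open LDSystem X
  open IsPermutative permutative
  open Hurwitz X
  open SetoidReasoning setoid

  *-identityˡ : ∀ x → 1# * x ≈ x
  *-identityˡ = proj₁ unique

  *-zeroʳ : ∀ x → x * 1# ≈ 1#
  *-zeroʳ x = proj₂ unique (x * 1#) (Li-leftIdeal x *-identityˡ)

  ≈1⇒*-identityˡ : ∀ {x y} → x ≈ 1# → x * y ≈ y
  ≈1⇒*-identityˡ {y = y} x≈1 = trans (*-cong x≈1 refl) (*-identityˡ y)

  ≈1⇒*-zeroʳ : ∀ {x y} → y ≈ 1# → x * y ≈ 1#
  ≈1⇒*-zeroʳ {x} y≈1 = trans (*-cong refl y≈1) (*-zeroʳ x)

  -- After `k` moves the second entry is `t k x y`. Permutativity makes it a left identity for some
  -- `k`, hence 1 by uniqueness, and the recursion is on that `k`.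
  hurwitz-induction : ∀ {p} (P : Carrier → Carrier → Set p) →
                      (∀ {x y} → y ≈ 1# → P x y) →
                      (∀ {x y} → P (x * y) x → P x y) →
                      ∀ x y → P x y
  hurwitz-induction P base step x y with t-reaches-Li x y
  ... | k , li = go k x y (proj₂ unique _ li)
    where
    go : ∀ k x y → t X k x y ≈ 1# → P x y
    go zero    x y t≈1 = base t≈1
    go (suc k) x y t≈1 =
      step (go k (x * y) x (trans (sym (reflexive (t-shift X k x y))) t≈1))

  -- The graph of the product. Halting is allowed at any pair with second entry 1, not only the
  -- first, so equality with 1 need not be decided and different stopping times can be compared.
  data Product (x y z : Carrier) : Set (c ⊔ ℓ) where
    halt : y ≈ 1# → z ≈ x → Product x y z
    move : Product (x * y) x z → Product x y z

  product-exists : ∀ x y → ∃ (Product x y)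
  product-exists = hurwitz-induction (λ x y → ∃ (Product x y))
    (λ {x} y≈1 → x , halt y≈1 refl) λ (z , p) → z , move p

  product-cong : ∀ {x x′ y y′ z} → x ≈ x′ → y ≈ y′ → Product x y z → Product x′ y′ z
  product-cong p q (halt y≈1 z≈x) = halt (trans (sym q) y≈1) (trans z≈x p)
  product-cong p q (move r)       = move (product-cong (*-cong p q) p r)

  mutual
    -- From (x , 1) the moves only alternate between (1 , x) and (x , 1), so every later halt yields
    -- the same element.
    product-identityʳ : ∀ {x y z} → y ≈ 1# → Product x y z → z ≈ x
    product-identityʳ y≈1 (halt _ z≈x) = z≈x
    product-identityʳ y≈1 (move p)     = product-identityˡ (≈1⇒*-zeroʳ y≈1) p

    product-identityˡ : ∀ {x y z} → x ≈ 1# → Product x y z → z ≈ y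
    product-identityˡ x≈1 (halt y≈1 z≈x) = trans z≈x (trans x≈1 (sym y≈1))
    product-identityˡ x≈1 (move p)       =
      trans (product-identityʳ x≈1 p) (≈1⇒*-identityˡ x≈1)

  product-unique : ∀ {x y z z′} → Product x y z → Product x y z′ → z ≈ z′
  product-unique (halt y≈1 z≈x) q               = trans z≈x (sym (product-identityʳ y≈1 q))
  product-unique p              (halt y≈1 z′≈x) = trans (product-identityʳ y≈1 p) (sym z′≈x)
  product-unique (move p)       (move q)        = product-unique p q

  infixl 7 _∘_
  _∘_ : Op₂ Carrier
  x ∘ y = proj₁ (product-exists x y)

  ∘-product : ∀ x y → Product x y (x ∘ y)
  ∘-product x y = proj₂ (product-exists x y)

  ∘-cong : ∀ {x x′ y y′} → x ≈ x′ → y ≈ y′ → x ∘ y ≈ x′ ∘ y′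
  ∘-cong p q = product-unique (product-cong p q (∘-product _ _)) (∘-product _ _)

  ∘-exchange : ∀ x y → x ∘ y ≈ (x * y) ∘ x
  ∘-exchange x y = product-unique (∘-product x y) (move (∘-product (x * y) x))

  ≈1⇒∘-identityʳ : ∀ {x y} → y ≈ 1# → x ∘ y ≈ x
  ≈1⇒∘-identityʳ y≈1 = product-identityʳ y≈1 (∘-product _ _)

  ≈1⇒∘-identityˡ : ∀ {x y} → x ≈ 1# → x ∘ y ≈ y
  ≈1⇒∘-identityˡ x≈1 = product-identityˡ x≈1 (∘-product _ _)

  ∘-isExchangeOp : IsExchangeOp X 1# _∘_
  ∘-isExchangeOp = record
    { ∘-cong    = ∘-cong
    ; exchange  = λ x y → sym (∘-exchange x y)
    ; identityʳ = λ x → sym (≈1⇒∘-identityʳ refl)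
    }

  ∘-unique : ∀ {_∘′_} → IsExchangeOp X 1# _∘′_ → _≐_ X _∘_ _∘′_
  ∘-unique {_∘′_} isExchangeOp = hurwitz-induction (λ x y → x ∘ y ≈ x ∘′ y)
    (λ {x} y≈1 → trans (≈1⇒∘-identityʳ y≈1)
      (trans (Op.identityʳ x) (Op.∘-cong refl (sym y≈1))))
    (λ {x} {y} p → trans (∘-exchange x y) (trans p (Op.exchange x y)))
    where module Op = IsExchangeOp isExchangeOp

  -- Left distributivity says precisely that `x * (y * z)` is unchanged by a move on (x , y).
  ∘-*-action : ∀ x y z → (x ∘ y) * z ≈ x * (y * z)
  ∘-*-action x y z = hurwitz-induction (λ x y → (x ∘ y) * z ≈ x * (y * z))
    (λ y≈1 → *-cong (≈1⇒∘-identityʳ y≈1) (sym (≈1⇒*-identityˡ y≈1)))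
    (λ {x} {y} p → begin
      (x ∘ y) * z        ≈⟨ *-cong (∘-exchange x y) refl ⟩
      ((x * y) ∘ x) * z  ≈⟨ p ⟩
      (x * y) * (x * z)  ≈⟨ *-distribˡ-* x y z ⟨
      x * (y * z)        ∎)
    x y

  -- Left multiplication by x is an endomorphism for `_*_`, so it carries moves to moves.
  *-distribˡ-∘ : ∀ x y z → x * (y ∘ z) ≈ (x * y) ∘ (x * z)
  *-distribˡ-∘ x = hurwitz-induction (λ y z → x * (y ∘ z) ≈ (x * y) ∘ (x * z))
    (λ z≈1 → trans (*-cong refl (≈1⇒∘-identityʳ z≈1))
      (sym (≈1⇒∘-identityʳ (≈1⇒*-zeroʳ z≈1))))
    (λ {y} {z} p → begin
      x * (y ∘ z)                    ≈⟨ *-cong refl (∘-exchange y z) ⟩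
      x * ((y * z) ∘ y)              ≈⟨ p ⟩
      (x * (y * z)) ∘ (x * y)        ≈⟨ ∘-cong (*-distribˡ-* x y z) refl ⟩
      ((x * y) * (x * z)) ∘ (x * y)  ≈⟨ ∘-exchange (x * y) (x * z) ⟨
      (x * y) ∘ (x * z)              ∎)

  -- Some power of Δ takes the triple to one with an entry 1.
  data Collapses (x y z : Carrier) : Set (c ⊔ ℓ) where
    unit₁ : x ≈ 1# → Collapses x y z
    unit₂ : y ≈ 1# → Collapses x y z
    unit₃ : z ≈ 1# → Collapses x y z
    Δ     : Collapses (x * (y * z)) (x * y) x → Collapses x y z

  collapses-cong : ∀ {x x′ y y′ z z′} → x ≈ x′ → y ≈ y′ → z ≈ z′ →
                   Collapses x y z → Collapses x′ y′ z′
  collapses-cong p q r (unit₁ x≈1) = unit₁ (trans (sym p) x≈1)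
  collapses-cong p q r (unit₂ y≈1) = unit₂ (trans (sym q) y≈1)
  collapses-cong p q r (unit₃ z≈1) = unit₃ (trans (sym r) z≈1)
  collapses-cong p q r (Δ d)       =
    Δ (collapses-cong (*-cong p (*-cong q r)) (*-cong p q) p d)

  mutual
    -- An entry 1 survives a generator, possibly at a neighbouring position. Past a Δ the generator
    -- changes its index, by σ₁Δ = Δσ₂ here and σ₂Δ = Δσ₁ below; both equations are instances of
    -- left distributivity.
    collapses-σ₁ : ∀ {x y z} → Collapses x y z → Collapses (x * y) x z
    collapses-σ₁ (unit₁ x≈1) = unit₂ x≈1
    collapses-σ₁ (unit₂ y≈1) = unit₁ (≈1⇒*-zeroʳ y≈1)
    collapses-σ₁ (unit₃ z≈1) = unit₃ z≈1
    collapses-σ₁ {x} {y} {z} (Δ d) =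
      Δ (collapses-cong (*-distribˡ-* x y z) refl refl (collapses-σ₂ d))

    collapses-σ₂ : ∀ {x y z} → Collapses x y z → Collapses x (y * z) y
    collapses-σ₂ (unit₁ x≈1) = unit₁ x≈1
    collapses-σ₂ (unit₂ y≈1) = unit₃ y≈1
    collapses-σ₂ (unit₃ z≈1) = unit₂ (≈1⇒*-zeroʳ z≈1)
    collapses-σ₂ {x} {y} {z} (Δ d) =
      Δ (collapses-cong (sym (*-distribˡ-* x (y * z) y)) refl refl (collapses-σ₁ d))

  -- Δ = σ₁σ₂σ₁.
  collapses-σ₁⁻¹ : ∀ {x y z} → Collapses (x * y) x z → Collapses x y z
  collapses-σ₁⁻¹ {x} {y} {z} d =
    Δ (collapses-cong (sym (*-distribˡ-* x y z)) refl refl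
      (collapses-σ₁ (collapses-σ₂ d)))

  -- Moves on the first two strands alone bring a 1 to the middle; they are then undone one at a
  -- time, each at the cost of one Δ.
  collapses : ∀ x y z → Collapses x y z
  collapses x y z = hurwitz-induction (λ x y → Collapses x y z) unit₂ collapses-σ₁⁻¹ x y

  collapses⇒assoc : ∀ {x y z} → Collapses x y z → (x ∘ y) ∘ z ≈ x ∘ (y ∘ z)
  collapses⇒assoc (unit₁ x≈1) =
    trans (∘-cong (≈1⇒∘-identityˡ x≈1) refl) (sym (≈1⇒∘-identityˡ x≈1))
  collapses⇒assoc (unit₂ y≈1) =
    ∘-cong (≈1⇒∘-identityʳ y≈1) (sym (≈1⇒∘-identityˡ y≈1))
  collapses⇒assoc (unit₃ z≈1) =
    trans (≈1⇒∘-identityʳ z≈1) (∘-cong refl (sym (≈1⇒∘-identityʳ z≈1)))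
  collapses⇒assoc {x} {y} {z} (Δ d) = begin
    (x ∘ y) ∘ z                        ≈⟨ ∘-exchange (x ∘ y) z ⟩
    ((x ∘ y) * z) ∘ (x ∘ y)            ≈⟨ ∘-cong (∘-*-action x y z) (∘-exchange x y) ⟩
    -- The left bracketing of the triple has become the right bracketing of its image under Δ, so
    -- the recursive call is used backwards.
    (x * (y * z)) ∘ ((x * y) ∘ x)      ≈⟨ collapses⇒assoc d ⟨
    ((x * (y * z)) ∘ (x * y)) ∘ x      ≈⟨ ∘-cong (*-distribˡ-∘ x (y * z) y) refl ⟨
    (x * ((y * z) ∘ y)) ∘ x            ≈⟨ ∘-cong (*-cong refl (∘-exchange y z)) refl ⟨
    (x * (y ∘ z)) ∘ x                  ≈⟨ ∘-exchange x (y ∘ z) ⟨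
    x ∘ (y ∘ z)                        ∎

  ∘-assoc : ∀ x y z → (x ∘ y) ∘ z ≈ x ∘ (y ∘ z)
  ∘-assoc x y z = collapses⇒assoc (collapses x y z)

  isLDMonoid : IsLDMonoid _≈_ _*_ _∘_ 1#
  isLDMonoid = record
    { ∘-isMonoid   = record
      { isSemigroup = record
        { isMagma = record { isEquivalence = isEquivalence ; ∙-cong = ∘-cong }
        ; assoc   = ∘-assoc
        }
      ; identity    = (λ x → ≈1⇒∘-identityˡ refl) , (λ x → ≈1⇒∘-identityʳ refl)
      }
    ; *-cong       = *-cong
    ; ∘-*-action   = ∘-*-action
    ; *-distribˡ-∘ = *-distribˡ-∘
    ; ∘-exchange   = ∘-exchange
    ; *-identityˡ  = *-identityˡ
    ; *-zeroʳ      = *-zeroʳ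
    }

  ∏ : ∀ {n} → Vec Carrier n → Carrier
  ∏ = foldr′ _∘_ 1#

  ∏-cong : ∀ {n} {xs ys : Vec Carrier n} → xs ≋ ys → ∏ xs ≈ ∏ ys
  ∏-cong []       = refl
  ∏-cong (p ∷ ps) = ∘-cong p (∏-cong ps)

  -- Associativity isolates the two adjacent factors that a generator touches, and exchange
  -- preserves their product.
  ∏-·σ : ∀ {n} (xs : Vec Carrier n) i → ∏ (xs ·σ i) ≈ ∏ xs
  ∏-·σ (x ∷ y ∷ xs) zero = begin
    (x * y) ∘ (x ∘ ∏ xs)  ≈⟨ ∘-assoc (x * y) x (∏ xs) ⟨
    ((x * y) ∘ x) ∘ ∏ xs  ≈⟨ ∘-cong (∘-exchange x y) refl ⟨
    (x ∘ y) ∘ ∏ xs        ≈⟨ ∘-assoc x y (∏ xs) ⟩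
    x ∘ (y ∘ ∏ xs)        ∎
  ∏-·σ (x ∷ xs@(_ ∷ _)) (suc i) = ∘-cong refl (∏-·σ xs i)

  ∏-· : ∀ {n} (xs : Vec Carrier n) s → ∏ (xs · s) ≈ ∏ xs
  ∏-· xs []      = refl
  ∏-· xs (i ∷ s) = trans (∏-· (xs ·σ i) s) (∏-·σ xs i)

  ∏-units : ∀ {n} (xs : Vec Carrier n) → (∀ i → lookup xs i ≈ 1#) → ∏ xs ≈ 1#
  ∏-units []       units = refl
  ∏-units (x ∷ xs) units =
    trans (≈1⇒∘-identityˡ (units zero)) (∏-units xs λ i → units (suc i))

  ∏-singleton : ∀ {n} (xs : Vec Carrier n) j →
                (∀ i → i ≡.≢ j → lookup xs i ≈ 1#) → ∏ xs ≈ lookup xs j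
  ∏-singleton (x ∷ xs) zero    units = ≈1⇒∘-identityʳ (∏-units xs λ i → units (suc i) λ ())
  ∏-singleton (x ∷ xs) (suc j) units =
    trans (≈1⇒∘-identityˡ (units zero λ ()))
      (∏-singleton xs j λ i i≢j → units (suc i) λ { ≡.refl → i≢j ≡.refl })

  -- The product is invariant under the action, so it can be evaluated at `y`, where a single factor
  -- remains.
  reductionGivesProduct : ReductionGivesProduct 1# _∘_
  reductionGivesProduct n x y s x·s≋y j units =
    trans (sym (∏-singleton y j units)) (trans (sym (∏-cong x·s≋y)) (∏-· x s))

theorem2p30 : ∀ {c ℓ} (X : LDSystem c ℓ) → IsPermutative X →
    (1# : LDSystem.Carrier X) → IsUniqueLeftIdentity X 1# →
    Σ[ ∘! ∈ ∃! (_≐_ X) (IsExchangeOp X 1#) ]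
    (IsLDMonoid (LDSystem._≈_ X) (LDSystem._*_ X) (proj₁ ∘!) 1# ×
    Hurwitz.ReductionGivesProduct X 1# (proj₁ ∘!))
theorem2p30 X permutative 1# unique =
  (_∘_ , ∘-isExchangeOp , ∘-unique) , isLDMonoid , reductionGivesProduct
  where open PermutativeLDSystem X permutative 1# unique
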